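{- Let $k$ be a positive integer, let $G$ be a graph, let $A\in\mathcal{S}(G)$, and let $p(x)\in\mathbb{R}_k[x]$ be a polynomial such that $p(A)$ is positive semidefinite and $\mathrm{tr}\,p(A)>0$. Then $$\vartheta(\overline{G^k})\geq\frac{e^\top p(A)e}{\mathrm{tr}\,p(A)},$$ where $e$ is the all-ones vector. Furthermore, if $p(A)$ is (entrywise) nonnegative, then $$\vartheta'(\overline{G^k})\geq\frac{e^\top p(A)e}{\mathrm{tr}\,p(A)}.$$
   Context: Graphs are finite, simple, undirected, with nonempty vertex set. $d(i,j)$ denotes the distance between vertices $i$ and $j$ in $G$ (with $d(i,j)=\infty$ if they lie in different components). The power graph $G^k$ has the same vertices as $G$, two distinct vertices being adjacent iff they are at distance at most $k$ in $G$. $\overline{H}$ denotes the complement of a graph $H$. $\mathbb{R}_k[x]$ is the set of real polynomials of degree at most $k$. $\mathcal{S}(G)$ is the set of real symmetric matrices $A$ indexed by the vertices of $G$ such that $(A)_{ij}=0$ whenever $d(i,j)>1$ (diagonal entries are arbitrary). Lovász theta function: an orthonormal representation of a graph $H$ with vertex set $\{1,\ldots,n\}$ is a set of unit real vectors $\{u_1,\ldots,u_n\}$ (in some Euclidean space) with $u_i^\top u_j=0$ whenever $i,j$ are distinct nonadjacent vertices; its value is $\min_c\max_{1\le i\le n}\frac{1}{(c^\top u_i)^2}$, with $c$ ranging over all unit real vectors; $\vartheta(H)$ is the minimum value over all orthonormal representations of $H$. By a theorem of Lovász (1979), which may be taken as known, $\vartheta(H)=\max_B e^\top Be$, where $B$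 ranges over all positive semidefinite real $n\times n$ matrices with $\mathrm{tr}\,B=1$ and $(B)_{ij}=0$ for every $\{i,j\}\in E(H)$. Schrijver theta function: $\vartheta'(H)=\max_B e^\top Be$, where $B$ ranges over all positive semidefinite, entrywise nonnegative real $n\times n$ matrices with $\mathrm{tr}\,B=1$ and $(B)_{ij}=0$ for every $\{i,j\}\in E(H)$. -}

module Defs where

open import Algebra.Bundles.Raw using (RawMonoid)
open import Data.Fin.Base using (Fin; toℕ)
import Data.Fin.Properties as Fin
open import Data.Nat.Base as ℕ using (ℕ; zero; suc)
import Data.Nat.Properties as ℕ
open import Data.Product.Base using (Σ; ∃; _×_; _,_; proj₁; proj₂)
open import Data.Rational.Base as ℚ using (ℚ; 0ℚ; 1ℚ; ½)
import Data.Rational.Properties as ℚ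
open import Data.Rational.Solver using (module +-*-Solver)
open import Data.Sum.Base using (_⊎_; inj₁; inj₂)
open import Data.Vec.Functional using (Vector)
open import Level using (0ℓ)
open import Relation.Binary.Core using (Rel)
open import Relation.Binary.Definitions using (Decidable; Irreflexive; Symmetric)
open import Relation.Binary.PropositionalEquality
  using (_≡_; _≢_; refl; sym; trans; cong; cong₂; subst; subst₂)
open import Relation.Nullary.Decidable using (Dec; yes; no; ¬?; _×-dec_; map′)
open import Relation.Nullary.Negation using (¬_; contradiction)

half-pos : ∀ {ε} → 0ℚ ℚ.< ε → 0ℚ ℚ.< ½ ℚ.* ε
half-pos 0<ε = ℚ.*-monoʳ-<-pos ½ 0<ε

half+half : ∀ ε → ½ ℚ.* ε ℚ.+ ½ ℚ.* ε ≡ ε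
half+half ε = trans (sym (ℚ.*-distribʳ-+ ε ½ ½)) (ℚ.*-identityˡ ε)

*-pos : ∀ {p q} → 0ℚ ℚ.< p → 0ℚ ℚ.< q → 0ℚ ℚ.< p ℚ.* q
*-pos {p} {q} 0<p 0<q = subst (ℚ._< p ℚ.* q) (ℚ.*-zeroʳ p)
  (ℚ.*-monoʳ-<-pos p {{ℚ.positive 0<p}} 0<q)

*-mono-≤ : ∀ {p q r s} → 0ℚ ℚ.≤ p → 0ℚ ℚ.≤ s →
           p ℚ.≤ q → r ℚ.≤ s → p ℚ.* r ℚ.≤ q ℚ.* s
*-mono-≤ {p} {q} {r} {s} 0≤p 0≤s p≤q r≤s = ℚ.≤-trans
  (ℚ.*-monoˡ-≤-nonNeg p {{ℚ.nonNegative 0≤p}} r≤s)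
  (ℚ.*-monoʳ-≤-nonNeg s {{ℚ.nonNegative 0≤s}} p≤q)

0≤∣_∣ : ∀ p → 0ℚ ℚ.≤ ℚ.∣ p ∣
0≤∣ p ∣ = ℚ.nonNegative⁻¹ ℚ.∣ p ∣ {{ℚ.∣-∣-nonNeg p}}

p≤∣p∣ : ∀ p → p ℚ.≤ ℚ.∣ p ∣
p≤∣p∣ p with ℚ.≤-total 0ℚ p
... | inj₁ 0≤p = ℚ.≤-reflexive (sym (ℚ.0≤p⇒∣p∣≡p 0≤p))
... | inj₂ p≤0 = ℚ.≤-trans p≤0 0≤∣ p ∣

positive-inverse : ∀ {p} → 0ℚ ℚ.< p → ∃ λ q → 0ℚ ℚ.< q × q ℚ.* p ≡ 1ℚ
positive-inverse {p} 0<p =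
  let instance
        p>0 = ℚ.positive 0<p
        p≢0 = ℚ.pos⇒nonZero p
  in ℚ.1/ p , ℚ.positive⁻¹ (ℚ.1/ p) {{ℚ.1/pos⇒pos p}} , ℚ.*-inverseˡ p

-- The reciprocal made total by 1/0 = 0.
invℚ : ℚ → ℚ
invℚ p with p ℚ.≟ 0ℚ
... | yes _   = 0ℚ
... | no p≢0 = ℚ.1/_ p {{ℚ.≢-nonZero p≢0}}

invℚ-inverseˡ : ∀ {p} → p ≢ 0ℚ → invℚ p ℚ.* p ≡ 1ℚ
invℚ-inverseˡ {p} p≢0 with p ℚ.≟ 0ℚ
... | yes p≡0 = contradiction p≡0 p≢0
... | no p≢0′ = ℚ.*-inverseˡ p {{ℚ.≢-nonZero p≢0′}}

Eventually : (ℕ → Set) → Set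
Eventually P = ∃ λ N → ∀ n → N ℕ.≤ n → P n

Cauchy : (ℕ → ℚ) → Set
Cauchy x = ∀ ε → 0ℚ ℚ.< ε →
  ∃ λ N → ∀ m n → N ℕ.≤ m → N ℕ.≤ n → ℚ.∣ x m ℚ.- x n ∣ ℚ.< ε

-- Equality of reals is the setoid equality _≈_ below, not _≡_.
record ℝ : Set where
  constructor mkℝ
  field
    seq    : ℕ → ℚ
    cauchy : Cauchy seq

open ℝ public

infix 4 _≈_ _<_ _≤_ _#_

_≈_ _<_ _≤_ _#_ : Rel ℝ 0ℓ
x ≈ y = ∀ ε → 0ℚ ℚ.< ε → Eventually λ n → ℚ.∣ seq x n ℚ.- seq y n ∣ ℚ.< ε
x < y = ∃ λ ε → 0ℚ ℚ.< ε × Eventually λ n → seq x n ℚ.+ ε ℚ.< seq y n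
x ≤ y = ∀ ε → 0ℚ ℚ.< ε → Eventually λ n → seq x n ℚ.< seq y n ℚ.+ ε
x # y = x < y ⊎ y < x

fromℚ : ℚ → ℝ
fromℚ p = mkℝ (λ _ → p) λ ε 0<ε → 0 , λ _ _ _ _ →
  subst (ℚ._< ε) (cong ℚ.∣_∣ (sym (ℚ.+-inverseʳ p))) 0<ε

0ℝ 1ℝ : ℝ
0ℝ = fromℚ 0ℚ
1ℝ = fromℚ 1ℚ

+-cauchy : ∀ x y → Cauchy (λ n → seq x n ℚ.+ seq y n)
+-cauchy x y ε 0<ε = M ℕ.⊔ N , close
  where
  M,p = cauchy x (½ ℚ.* ε) (half-pos 0<ε)
  N,q = cauchy y (½ ℚ.* ε) (half-pos 0<ε)
  M = proj₁ M,p
  N = proj₁ N,q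

  regroup : ∀ a b c d →
            (a ℚ.+ b) ℚ.- (c ℚ.+ d) ≡ (a ℚ.- c) ℚ.+ (b ℚ.- d)
  regroup = solve 4 (λ a b c d →
    (a :+ b) :- (c :+ d) := (a :- c) :+ (b :- d)) refl
    where open +-*-Solver

  close : ∀ m n → M ℕ.⊔ N ℕ.≤ m → M ℕ.⊔ N ℕ.≤ n →
          ℚ.∣ (seq x m ℚ.+ seq y m) ℚ.- (seq x n ℚ.+ seq y n) ∣ ℚ.< ε
  close m n m≥ n≥ = begin-strict
    ℚ.∣ (seq x m ℚ.+ seq y m) ℚ.- (seq x n ℚ.+ seq y n) ∣
      ≡⟨ cong ℚ.∣_∣ (regroup (seq x m) (seq y m) (seq x n) (seq y n)) ⟩
    ℚ.∣ dx ℚ.+ dy ∣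
      ≤⟨ ℚ.∣p+q∣≤∣p∣+∣q∣ dx dy ⟩
    ℚ.∣ dx ∣ ℚ.+ ℚ.∣ dy ∣
      <⟨ ℚ.+-mono-<
           (proj₂ M,p m n (ℕ.m⊔n≤o⇒m≤o M N m≥) (ℕ.m⊔n≤o⇒m≤o M N n≥))
           (proj₂ N,q m n (ℕ.m⊔n≤o⇒n≤o M N m≥) (ℕ.m⊔n≤o⇒n≤o M N n≥)) ⟩
    ½ ℚ.* ε ℚ.+ ½ ℚ.* ε
      ≡⟨ half+half ε ⟩
    ε ∎
    where
    open ℚ.≤-Reasoning
    dx = seq x m ℚ.- seq x n
    dy = seq y m ℚ.- seq y n

eventually-bounded : ∀ x → ∃ λ K → 0ℚ ℚ.≤ K ×
                     Eventually λ n → ℚ.∣ seq x n ∣ ℚ.≤ K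
eventually-bounded x = K , 0≤K , N , bound
  where
  N = proj₁ (cauchy x 1ℚ (ℚ.positive⁻¹ 1ℚ))
  K = 1ℚ ℚ.+ ℚ.∣ seq x N ∣

  0≤K : 0ℚ ℚ.≤ K
  0≤K = ℚ.+-mono-≤ (ℚ.nonNegative⁻¹ 1ℚ) 0≤∣ seq x N ∣

  split : ∀ a b → a ≡ (a ℚ.- b) ℚ.+ b
  split = solve 2 (λ a b → a := (a :- b) :+ b) refl
    where open +-*-Solver

  bound : ∀ n → N ℕ.≤ n → ℚ.∣ seq x n ∣ ℚ.≤ K
  bound n n≥ = begin
    ℚ.∣ seq x n ∣
      ≡⟨ cong ℚ.∣_∣ (split (seq x n) (seq x N)) ⟩
    ℚ.∣ (seq x n ℚ.- seq x N) ℚ.+ seq x N ∣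
      ≤⟨ ℚ.∣p+q∣≤∣p∣+∣q∣ (seq x n ℚ.- seq x N) (seq x N) ⟩
    ℚ.∣ seq x n ℚ.- seq x N ∣ ℚ.+ ℚ.∣ seq x N ∣
      ≤⟨ ℚ.+-monoˡ-≤ ℚ.∣ seq x N ∣ (ℚ.<⇒≤
           (proj₂ (cauchy x 1ℚ (ℚ.positive⁻¹ 1ℚ)) n N n≥ ℕ.≤-refl)) ⟩
    K ∎
    where open ℚ.≤-Reasoning

*-cauchy : ∀ x y → Cauchy (λ n → seq x n ℚ.* seq y n)
*-cauchy x y ε 0<ε = L , close
  where
  Kx,p = eventually-bounded x
  Ky,q = eventually-bounded y
  Kx = proj₁ Kx,p
  Ky = proj₁ Ky,q
  K = 1ℚ ℚ.+ (Kx ℚ.+ Ky)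
  0≤Kx = proj₁ (proj₂ Kx,p)
  0≤Ky = proj₁ (proj₂ Ky,q)

  0<K : 0ℚ ℚ.< K
  0<K = ℚ.+-mono-<-≤ (ℚ.positive⁻¹ 1ℚ) (ℚ.+-mono-≤ 0≤Kx 0≤Ky)

  0≤K : 0ℚ ℚ.≤ K
  0≤K = ℚ.<⇒≤ 0<K

  Kx≤K : Kx ℚ.≤ K
  Kx≤K = subst (ℚ._≤ K) (trans (ℚ.+-identityˡ _) (ℚ.+-identityʳ Kx))
    (ℚ.+-mono-≤ (ℚ.nonNegative⁻¹ 1ℚ) (ℚ.+-monoʳ-≤ Kx 0≤Ky))

  Ky≤K : Ky ℚ.≤ K
  Ky≤K = subst (ℚ._≤ K) (trans (ℚ.+-identityˡ _) (ℚ.+-identityˡ Ky))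
    (ℚ.+-mono-≤ (ℚ.nonNegative⁻¹ 1ℚ) (ℚ.+-monoˡ-≤ Ky 0≤Kx))

  I,i = positive-inverse 0<K
  I = proj₁ I,i
  δ = I ℚ.* (½ ℚ.* ε)

  0<δ : 0ℚ ℚ.< δ
  0<δ = *-pos (proj₁ (proj₂ I,i)) (half-pos 0<ε)

  Kδ : K ℚ.* δ ≡ ½ ℚ.* ε
  Kδ = trans (sym (ℚ.*-assoc K I _))
    (trans (cong (ℚ._* (½ ℚ.* ε)) (trans (ℚ.*-comm K I) (proj₂ (proj₂ I,i))))
      (ℚ.*-identityˡ _))

  M₁ = proj₁ (proj₂ (proj₂ Kx,p))
  M₂ = proj₁ (proj₂ (proj₂ Ky,q))
  N₁ = proj₁ (cauchy x δ 0<δ)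
  N₂ = proj₁ (cauchy y δ 0<δ)
  L = (M₁ ℕ.⊔ M₂) ℕ.⊔ (N₁ ℕ.⊔ N₂)

  M≤ : ∀ {m} → L ℕ.≤ m → M₁ ℕ.⊔ M₂ ℕ.≤ m
  M≤ = ℕ.m⊔n≤o⇒m≤o (M₁ ℕ.⊔ M₂) (N₁ ℕ.⊔ N₂)

  N≤ : ∀ {m} → L ℕ.≤ m → N₁ ℕ.⊔ N₂ ℕ.≤ m
  N≤ = ℕ.m⊔n≤o⇒n≤o (M₁ ℕ.⊔ M₂) (N₁ ℕ.⊔ N₂)

  regroup : ∀ a b c d → a ℚ.* b ℚ.- c ℚ.* d ≡
            a ℚ.* (b ℚ.- d) ℚ.+ d ℚ.* (a ℚ.- c)
  regroup = solve 4 (λ a b c d →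
    a :* b :- c :* d := a :* (b :- d) :+ d :* (a :- c)) refl
    where open +-*-Solver

  close : ∀ m n → L ℕ.≤ m → L ℕ.≤ n →
          ℚ.∣ seq x m ℚ.* seq y m ℚ.- seq x n ℚ.* seq y n ∣ ℚ.< ε
  close m n m≥ n≥ = begin-strict
    ℚ.∣ seq x m ℚ.* seq y m ℚ.- seq x n ℚ.* seq y n ∣
      ≡⟨ cong ℚ.∣_∣ (regroup (seq x m) (seq y m) (seq x n) (seq y n)) ⟩
    ℚ.∣ seq x m ℚ.* dy ℚ.+ seq y n ℚ.* dx ∣
      ≤⟨ ℚ.∣p+q∣≤∣p∣+∣q∣ (seq x m ℚ.* dy) (seq y n ℚ.* dx) ⟩
    ℚ.∣ seq x m ℚ.* dy ∣ ℚ.+ ℚ.∣ seq y n ℚ.* dx ∣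
      ≡⟨ cong₂ ℚ._+_ (ℚ.∣p*q∣≡∣p∣*∣q∣ (seq x m) dy)
                     (ℚ.∣p*q∣≡∣p∣*∣q∣ (seq y n) dx) ⟩
    ℚ.∣ seq x m ∣ ℚ.* ℚ.∣ dy ∣ ℚ.+ ℚ.∣ seq y n ∣ ℚ.* ℚ.∣ dx ∣
      ≤⟨ ℚ.+-mono-≤
           (*-mono-≤ 0≤∣ seq x m ∣ 0≤∣ dy ∣ (ℚ.≤-trans
             (proj₂ (proj₂ (proj₂ Kx,p)) m (ℕ.m⊔n≤o⇒m≤o M₁ M₂ (M≤ m≥))) Kx≤K)
             ℚ.≤-refl)
           (*-mono-≤ 0≤∣ seq y n ∣ 0≤∣ dx ∣ (ℚ.≤-trans
             (proj₂ (proj₂ (proj₂ Ky,q)) n (ℕ.m⊔n≤o⇒n≤o M₁ M₂ (M≤ n≥))) Ky≤K)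
             ℚ.≤-refl) ⟩
    K ℚ.* ℚ.∣ dy ∣ ℚ.+ K ℚ.* ℚ.∣ dx ∣
      <⟨ ℚ.+-mono-<
           (ℚ.*-monoʳ-<-pos K {{ℚ.positive 0<K}}
             (proj₂ (cauchy y δ 0<δ) m n
               (ℕ.m⊔n≤o⇒n≤o N₁ N₂ (N≤ m≥)) (ℕ.m⊔n≤o⇒n≤o N₁ N₂ (N≤ n≥))))
           (ℚ.*-monoʳ-<-pos K {{ℚ.positive 0<K}}
             (proj₂ (cauchy x δ 0<δ) m n
               (ℕ.m⊔n≤o⇒m≤o N₁ N₂ (N≤ m≥)) (ℕ.m⊔n≤o⇒m≤o N₁ N₂ (N≤ n≥)))) ⟩
    K ℚ.* δ ℚ.+ K ℚ.* δ
      ≡⟨ cong₂ ℚ._+_ Kδ Kδ ⟩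
    ½ ℚ.* ε ℚ.+ ½ ℚ.* ε
      ≡⟨ half+half ε ⟩
    ε ∎
    where
    open ℚ.≤-Reasoning
    dx = seq x m ℚ.- seq x n
    dy = seq y m ℚ.- seq y n

away-from-0 : ∀ x → x # 0ℝ → ∃ λ ε → 0ℚ ℚ.< ε ×
              Eventually λ n → ε ℚ.≤ ℚ.∣ seq x n ∣
away-from-0 x (inj₂ (ε , 0<ε , N , p)) = ε , 0<ε , N , λ n n≥ →
  ℚ.≤-trans (ℚ.<⇒≤ (subst (ℚ._< seq x n) (ℚ.+-identityˡ ε) (p n n≥)))
            (p≤∣p∣ (seq x n))
away-from-0 x (inj₁ (ε , 0<ε , N , p)) = ε , 0<ε , N , λ n n≥ →
  ℚ.≤-trans (ℚ.<⇒≤ (subst₂ ℚ._<_ (cancel (seq x n) ε) (ℚ.+-identityʳ _)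
              (ℚ.+-monoʳ-< (ℚ.- seq x n) (p n n≥))))
            (subst (ℚ.- seq x n ℚ.≤_) (ℚ.∣-p∣≡∣p∣ (seq x n)) (p≤∣p∣ (ℚ.- seq x n)))
  where
  cancel : ∀ a b → ℚ.- a ℚ.+ (a ℚ.+ b) ≡ b
  cancel = solve 2 (λ a b → :- a :+ (a :+ b) := b) refl
    where open +-*-Solver

recip-cauchy : ∀ x → x # 0ℝ → Cauchy (λ n → invℚ (seq x n))
recip-cauchy x x#0 ε 0<ε = M ℕ.⊔ N , close
  where
  away = away-from-0 x x#0
  η = proj₁ away
  0<η = proj₁ (proj₂ away)
  M = proj₁ (proj₂ (proj₂ away))
  η≤ = proj₂ (proj₂ (proj₂ away))
  J,j = positive-inverse 0<η
  J = proj₁ J,j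
  0<J = proj₁ (proj₂ J,j)
  Jη = proj₂ (proj₂ J,j)
  δ = (η ℚ.* η) ℚ.* ε

  0<δ : 0ℚ ℚ.< δ
  0<δ = *-pos (*-pos 0<η 0<η) 0<ε

  N = proj₁ (cauchy x δ 0<δ)

  nonzero : ∀ n → M ℕ.≤ n → seq x n ≢ 0ℚ
  nonzero n n≥ xₙ≡0 = ℚ.<-irrefl refl
    (ℚ.<-≤-trans 0<η (subst (η ℚ.≤_) (cong ℚ.∣_∣ xₙ≡0) (η≤ n n≥)))

  inv : ∀ n → M ℕ.≤ n → invℚ (seq x n) ℚ.* seq x n ≡ 1ℚ
  inv n n≥ = invℚ-inverseˡ (nonzero n n≥)

  ∣inv∣≤J : ∀ n → M ℕ.≤ n → ℚ.∣ invℚ (seq x n) ∣ ℚ.≤ J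
  ∣inv∣≤J n n≥ = begin
    ℚ.∣ i ∣
      ≡⟨ sym (ℚ.*-identityˡ _) ⟩
    1ℚ ℚ.* ℚ.∣ i ∣
      ≡⟨ cong (ℚ._* ℚ.∣ i ∣) (sym Jη) ⟩
    (J ℚ.* η) ℚ.* ℚ.∣ i ∣
      ≡⟨ ℚ.*-assoc J η _ ⟩
    J ℚ.* (η ℚ.* ℚ.∣ i ∣)
      ≤⟨ ℚ.*-monoˡ-≤-nonNeg J {{ℚ.nonNegative (ℚ.<⇒≤ 0<J)}}
           (ℚ.*-monoʳ-≤-nonNeg ℚ.∣ i ∣ {{ℚ.∣-∣-nonNeg i}} (η≤ n n≥)) ⟩
    J ℚ.* (ℚ.∣ seq x n ∣ ℚ.* ℚ.∣ i ∣)
      ≡⟨ cong (J ℚ.*_) (trans (ℚ.*-comm ℚ.∣ seq x n ∣ ℚ.∣ i ∣)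
           (trans (sym (ℚ.∣p*q∣≡∣p∣*∣q∣ i (seq x n)))
             (cong ℚ.∣_∣ (inv n n≥)))) ⟩
    J ℚ.* 1ℚ
      ≡⟨ ℚ.*-identityʳ J ⟩
    J ∎
    where
    open ℚ.≤-Reasoning
    i = invℚ (seq x n)

  difference : ∀ {a b i j} → i ℚ.* a ≡ 1ℚ → j ℚ.* b ≡ 1ℚ →
               i ℚ.- j ≡ (i ℚ.* j) ℚ.* (b ℚ.- a)
  difference {a} {b} {i} {j} ia jb = trans
    (cong₂ ℚ._-_
      (trans (sym (ℚ.*-identityʳ i)) (cong (i ℚ.*_) (sym jb)))
      (trans (sym (ℚ.*-identityʳ j)) (cong (j ℚ.*_) (sym ia))))
    (regroup a b i j)
    where
    regroup : ∀ a b i j → i ℚ.* (j ℚ.* b) ℚ.- j ℚ.* (i ℚ.* a) ≡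
              (i ℚ.* j) ℚ.* (b ℚ.- a)
    regroup = solve 4 (λ a b i j →
      i :* (j :* b) :- j :* (i :* a) := (i :* j) :* (b :- a)) refl
      where open +-*-Solver

  JJδ : (J ℚ.* J) ℚ.* δ ≡ ε
  JJδ = trans (regroup J η ε)
    (trans (cong (λ r → (r ℚ.* r) ℚ.* ε) Jη) (ℚ.*-identityˡ ε))
    where
    regroup : ∀ J η ε → (J ℚ.* J) ℚ.* ((η ℚ.* η) ℚ.* ε) ≡
              ((J ℚ.* η) ℚ.* (J ℚ.* η)) ℚ.* ε
    regroup = solve 3 (λ J η ε →
      (J :* J) :* ((η :* η) :* ε) := ((J :* η) :* (J :* η)) :* ε) refl
      where open +-*-Solver

  close : ∀ m n → M ℕ.⊔ N ℕ.≤ m → M ℕ.⊔ N ℕ.≤ n →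
          ℚ.∣ invℚ (seq x m) ℚ.- invℚ (seq x n) ∣ ℚ.< ε
  close m n m≥ n≥ = begin-strict
    ℚ.∣ i ℚ.- j ∣
      ≡⟨ cong ℚ.∣_∣ (difference {seq x m} {seq x n} {i} {j} (inv m m≥M) (inv n n≥M)) ⟩
    ℚ.∣ (i ℚ.* j) ℚ.* d ∣
      ≡⟨ trans (ℚ.∣p*q∣≡∣p∣*∣q∣ (i ℚ.* j) d)
           (cong (ℚ._* ℚ.∣ d ∣) (ℚ.∣p*q∣≡∣p∣*∣q∣ i j)) ⟩
    (ℚ.∣ i ∣ ℚ.* ℚ.∣ j ∣) ℚ.* ℚ.∣ d ∣
      ≤⟨ ℚ.*-monoʳ-≤-nonNeg ℚ.∣ d ∣ {{ℚ.∣-∣-nonNeg d}}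
           (*-mono-≤ 0≤∣ i ∣ (ℚ.<⇒≤ 0<J) (∣inv∣≤J m m≥M) (∣inv∣≤J n n≥M)) ⟩
    (J ℚ.* J) ℚ.* ℚ.∣ d ∣
      <⟨ ℚ.*-monoʳ-<-pos (J ℚ.* J) {{ℚ.positive (*-pos 0<J 0<J)}}
           (proj₂ (cauchy x δ 0<δ) n m
             (ℕ.m⊔n≤o⇒n≤o M N n≥) (ℕ.m⊔n≤o⇒n≤o M N m≥)) ⟩
    (J ℚ.* J) ℚ.* δ
      ≡⟨ JJδ ⟩
    ε ∎
    where
    open ℚ.≤-Reasoning
    i = invℚ (seq x m)
    j = invℚ (seq x n)
    d = seq x n ℚ.- seq x m
    m≥M = ℕ.m⊔n≤o⇒m≤o M N m≥
    n≥M = ℕ.m⊔n≤o⇒m≤o M N n≥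

infixl 6 _+_
infixl 7 _*_

_+_ _*_ : ℝ → ℝ → ℝ
x + y = mkℝ (λ n → seq x n ℚ.+ seq y n) (+-cauchy x y)
x * y = mkℝ (λ n → seq x n ℚ.* seq y n) (*-cauchy x y)

recip : (x : ℝ) → x # 0ℝ → ℝ
recip x x#0 = mkℝ (λ n → invℚ (seq x n)) (recip-cauchy x x#0)

infixl 7 _/_⟨_⟩

_/_⟨_⟩ : (x y : ℝ) → y # 0ℝ → ℝ
x / y ⟨ y#0 ⟩ = x * recip y y#0

+-0-rawMonoid : RawMonoid 0ℓ 0ℓ
+-0-rawMonoid = record { Carrier = ℝ ; _≈_ = _≈_ ; _∙_ = _+_ ; ε = 0ℝ }

open import Algebra.Definitions.RawMonoid +-0-rawMonoid public using (sum)

IsMinimum IsMaximum : (ℝ → Set) → ℝ → Set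
IsMinimum P t = P t × (∀ s → P s → t ≤ s)
IsMaximum P t = P t × (∀ s → P s → s ≤ t)

infix 8 _∙_

_∙_ : ∀ {n} → Vector ℝ n → Vector ℝ n → ℝ
x ∙ y = sum λ i → x i * y i

Unit : ∀ {n} → Vector ℝ n → Set
Unit x = x ∙ x ≈ 1ℝ

𝟏 : ∀ {n} → Vector ℝ n
𝟏 _ = 1ℝ

Matrix : ℕ → Set
Matrix n = Fin n → Fin n → ℝ

identity : ∀ {n} → Matrix n
identity i j with i Fin.≟ j
... | yes _ = 1ℝ
... | no  _ = 0ℝ

infixl 7 _*ᴹ_ _*ᵛ_

_*ᴹ_ : ∀ {n} → Matrix n → Matrix n → Matrix n
(A *ᴹ B) i j = sum λ l → A i l * B l j

_*ᵛ_ : ∀ {n} → Matrix n → Vector ℝ n → Vector ℝ n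
(A *ᵛ x) i = A i ∙ x

infixr 8 _^ᴹ_

_^ᴹ_ : ∀ {n} → Matrix n → ℕ → Matrix n
A ^ᴹ zero  = identity
A ^ᴹ suc l = A *ᴹ A ^ᴹ l

tr : ∀ {n} → Matrix n → ℝ
tr A = sum λ i → A i i

SymmetricMatrix Nonnegative PSD : ∀ {n} → Matrix n → Set
SymmetricMatrix A = ∀ i j → A i j ≈ A j i
Nonnegative A     = ∀ i j → 0ℝ ≤ A i j
PSD A             = SymmetricMatrix A × (∀ x → 0ℝ ≤ x ∙ (A *ᵛ x))

-- Entry l is the coefficient of the l-th power of the indeterminate; the
-- leading entry may vanish.
Polynomial≤ : ℕ → Set
Polynomial≤ k = Vector ℝ (suc k)

infix 9 _⟦_⟧

_⟦_⟧ : ∀ {k n} → Polynomial≤ k → Matrix n → Matrix n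
(p ⟦ A ⟧) i j = sum λ l → p l * (A ^ᴹ toℕ l) i j

record Graph (n : ℕ) : Set₁ where
  field
    Adj        : Rel (Fin n) 0ℓ
    adj?       : Decidable Adj
    adj-sym    : Symmetric Adj
    adj-irrefl : Irreflexive _≡_ Adj

open Graph public

complement : ∀ {n} → Graph n → Graph n
complement G = record
  { Adj        = λ i j → i ≢ j × ¬ Adj G i j
  ; adj?       = λ i j → ¬? (i Fin.≟ j) ×-dec ¬? (adj? G i j)
  ; adj-sym    = λ (i≢j , ¬ij) → (λ j≡i → i≢j (sym j≡i)) , λ ji → ¬ij (adj-sym G ji)
  ; adj-irrefl = λ i≡j (i≢j , _) → i≢j i≡j
  }

module _ {n} (G : Graph n) where

  data Walk : ℕ → Rel (Fin n) 0ℓ where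
    []  : ∀ {i} → Walk 0 i i
    _∷_ : ∀ {l i j m} → Adj G i j → Walk l j m → Walk (suc l) i m

  -- "d(i,j) is finite and equal to d".
  IsDistance : Fin n → Fin n → ℕ → Set
  IsDistance i j d = Walk d i j × (∀ {l} → Walk l i j → d ℕ.≤ l)

  -- d(i,j) ≤ k; its negation includes the case d(i,j) = ∞.
  Distance≤ : ℕ → Rel (Fin n) 0ℓ
  Distance≤ k i j = ∃ λ d → d ℕ.≤ k × IsDistance i j d

  snoc : ∀ {l i j m} → Walk l i j → Adj G j m → Walk (suc l) i m
  snoc []      f = f ∷ []
  snoc (e ∷ w) f = e ∷ snoc w f

  reverse : ∀ {l i j} → Walk l i j → Walk l j i
  reverse []      = []
  reverse (e ∷ w) = snoc (reverse w) (adj-sym G e)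

  walk? : ∀ l → Decidable (Walk l)
  walk? zero i j = map′ (λ { refl → [] }) (λ { [] → refl }) (i Fin.≟ j)
  walk? (suc l) i j =
    map′ (λ (_ , e , w) → e ∷ w) (λ { (e ∷ w) → _ , e , w })
      (Fin.any? λ m → adj? G i m ×-dec walk? l m j)

  isDistance? : ∀ i j d → Dec (IsDistance i j d)
  isDistance? i j d = map′
    (λ (w , none) → w , λ v → ℕ.≮⇒≥ λ l<d → none (_ , l<d , v))
    (λ (w , least) → w , λ (_ , l<d , v) → ℕ.<⇒≱ l<d (least v))
    (walk? d i j ×-dec ¬? (ℕ.anyUpTo? (λ l → walk? l i j) d))

  distance≤? : ∀ k → Decidable (Distance≤ k)
  distance≤? k i j = map′
    (λ (d , d<1+k , p) → d , ℕ.s≤s⁻¹ d<1+k , p)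
    (λ (d , d≤k , p) → d , ℕ.s≤s d≤k , p)
    (ℕ.anyUpTo? (isDistance? i j) (suc k))

  distance≤-sym : ∀ k → Symmetric (Distance≤ k)
  distance≤-sym k (d , d≤k , w , least) =
    d , d≤k , reverse w , λ v → least (reverse v)

infixl 8 _^ᴳ_

_^ᴳ_ : ∀ {n} → Graph n → ℕ → Graph n
G ^ᴳ k = record
  { Adj        = λ i j → i ≢ j × Distance≤ G k i j
  ; adj?       = λ i j → ¬? (i Fin.≟ j) ×-dec distance≤? G k i j
  ; adj-sym    = λ (i≢j , d≤k) → (λ j≡i → i≢j (sym j≡i)) , distance≤-sym G k d≤k
  ; adj-irrefl = λ i≡j (i≢j , _) → i≢j i≡j
  }

infix 4 _∈𝒮_

_∈𝒮_ : ∀ {n} → Matrix n → Graph n → Set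
A ∈𝒮 G = SymmetricMatrix A × (∀ i j → ¬ Distance≤ G 1 i j → A i j ≈ 0ℝ)

IsOrthonormalRep : ∀ {n m} → Graph n → (Fin n → Vector ℝ m) → Set
IsOrthonormalRep H u =
  (∀ i → Unit (u i)) × (∀ i j → i ≢ j → ¬ Adj H i j → u i ∙ u j ≈ 0ℝ)

-- t is the maximum over i of 1/(cᵀuᵢ)². If some cᵀuᵢ vanishes this maximum
-- is ∞, so no real t qualifies; such c never attain the minimum below, as
-- finitely many hyperplanes do not cover the unit sphere.
IsMaxRecip : ∀ {n m} → (Fin n → Vector ℝ m) → Vector ℝ m → ℝ → Set
IsMaxRecip u c t =
  Σ (∀ i → (c ∙ u i) * (c ∙ u i) # 0ℝ) λ nonzero →
  IsMaximum (λ s → ∃ λ i → s ≈ recip ((c ∙ u i) * (c ∙ u i)) (nonzero i)) t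

IsValue : ∀ {n m} → (Fin n → Vector ℝ m) → ℝ → Set
IsValue u = IsMinimum λ s → ∃ λ c → Unit c × IsMaxRecip u c s

-- Isϑ H t and Isϑ′ H t read ϑ(H) = t and ϑ′(H) = t. They are relations because
-- the existence of the extrema rests on compactness, which is not constructive.
Isϑ : ∀ {n} → Graph n → ℝ → Set
Isϑ {n} H = IsMinimum λ s →
  ∃ λ m → ∃ λ (u : Fin n → Vector ℝ m) → IsOrthonormalRep H u × IsValue u s

Isϑ′ : ∀ {n} → Graph n → ℝ → Set
Isϑ′ {n} H = IsMaximum λ s → ∃ λ (B : Matrix n) →
  PSD B × Nonnegative B × tr B ≈ 1ℝ × (∀ i j → Adj H i j → B i j ≈ 0ℝ) ×
  s ≈ 𝟏 ∙ (B *ᵛ 𝟏)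

{-# OPTIONS --safe #-}

-- Weak duality for ϑ. Let P be positive semidefinite, and let u be an
-- orthonormal representation with unit handle c such that P i j (uᵢ·uⱼ) = 0
-- for i ≠ j. Put vᵢ = c - uᵢ/(c·uᵢ), so that vᵢ·vⱼ = uᵢ·uⱼ/((c·uᵢ)(c·uⱼ)) - 1.
-- Evaluating the quadratic form of P on every coordinate of the vᵢ and adding
-- up gives 0 ≤ Σ P i i/(c·uᵢ)² - eᵀPe, hence eᵀPe ≤ t tr P as soon as
-- 1/(c·uᵢ)² ≤ t for all i. An entry of p(A) at distance more than k vanishes,
-- because a nonzero entry of Aˡ requires a walk of length at most l.
module Submission where

open import Algebra.Bundles using (CommutativeRing)
import Algebra.Properties.Semiring.Sum as Sum
open import Data.Fin.Base using (Fin; zero; suc; punchIn; toℕ)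
import Data.Fin.Properties as Fin
open import Data.Nat.Base as ℕ using (ℕ; zero; suc; NonZero)
open import Data.Nat.Induction using (<-rec)
import Data.Nat.Properties as ℕ
open import Data.Product.Base using (∃; _×_; _,_; proj₁; proj₂)
open import Data.Rational.Base as ℚ using (ℚ; 0ℚ; 1ℚ; ½)
import Data.Rational.Properties as ℚ
open import Data.Rational.Solver using (module +-*-Solver)
open import Data.Sum.Base using (inj₁; inj₂)
open import Data.Vec.Functional using (Vector)
open import Function.Base using (_∘_)
open import Level using (0ℓ)
open import Relation.Binary.Bundles using (Preorder)
open import Relation.Binary.Core using (Rel)
open import Relation.Binary.Structures using (IsPreorder)
import Relation.Binary.Reasoning.Preorder as PreorderReasoning
open import Relation.Binary.PropositionalEquality as ≡ using (_≡_; _≢_; _≗_)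
open import Relation.Nullary.Decidable using (Dec; yes; no)
open import Relation.Nullary.Negation using (¬_; contradiction)

open import Defs

-- Duality is proved over an abstract ring so that Cauchy moduli stay opaque. The order is a mere
-- preorder because totality of `≤` on Cauchy reals is not constructive.
record OrderedRing : Set₁ where
  infix 4 _≲_
  field
    commutativeRing : CommutativeRing 0ℓ 0ℓ
  open CommutativeRing commutativeRing using (Carrier; 0#)
    renaming (_≈_ to _≃_; _+_ to _⊕_; _*_ to _⊗_)
  field
    _≲_          : Rel Carrier 0ℓ
    ≲-isPreorder : IsPreorder _≃_ _≲_
    +-mono-≲     : ∀ {w x y z} → w ≲ x → y ≲ z → (w ⊕ y) ≲ (x ⊕ z)
    *-nonneg     : ∀ {x y} → 0# ≲ x → 0# ≲ y → 0# ≲ (x ⊗ y)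

-- Finite sums and quadratic forms over an ordered ring.

module OrderedRingProperties (O : OrderedRing) where

  open OrderedRing O
  open CommutativeRing commutativeRing hiding (zero)
    renaming (_≈_ to _≃_; _+_ to _⊕_; _*_ to _⊗_; -_ to ⊝_)
  open import Algebra.Properties.Ring ring using (-‿distribˡ-*; -‿distribʳ-*; -‿involutive)
  open import Algebra.Properties.CommutativeSemigroup *-commutativeSemigroup
    using (x∙yz≈y∙xz)
  open Sum semiring renaming (sum to Σ)
  open IsPreorder ≲-isPreorder using ()
    renaming (reflexive to ≲-reflexive; refl to ≲-refl; trans to ≲-trans)

  ≲-preorder : Preorder 0ℓ 0ℓ 0ℓ
  ≲-preorder = record { isPreorder = ≲-isPreorder }

  open PreorderReasoning ≲-preorder

  infix 8 _·_

  _·_ : ∀ {n} → Vector Carrier n → Vector Carrier n → Carrier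
  x · y = Σ λ i → x i ⊗ y i

  quadratic : ∀ {n} → (Fin n → Fin n → Carrier) → Vector Carrier n → Carrier
  quadratic P x = x · λ i → P i · x

  *-zero-factorˡ : ∀ x y → x ≃ 0# → x ⊗ y ≃ 0#
  *-zero-factorˡ x y x≃0 = trans (*-congʳ x≃0) (zeroˡ y)

  *-zero-factorʳ : ∀ x y → y ≃ 0# → x ⊗ y ≃ 0#
  *-zero-factorʳ x y y≃0 = trans (*-congˡ y≃0) (zeroʳ x)

  Σ-zero : ∀ {n} (f : Vector Carrier n) → (∀ i → f i ≃ 0#) → Σ f ≃ 0#
  Σ-zero {n} f f≃0 = trans (sum-cong-≋ f≃0) (sum-replicate-zero n)

  Σ-cong : ∀ {n} (f g : Vector Carrier n) → (∀ i → f i ≃ g i) → Σ f ≃ Σ g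
  Σ-cong f g = sum-cong-≋

  Σ-single : ∀ {n} (f : Vector Carrier n) i → (∀ j → i ≢ j → f j ≃ 0#) → Σ f ≃ f i
  Σ-single {suc n} f i f≃0 = begin-equality
    Σ f                            ≈⟨ sum-remove {i = i} f ⟩
    f i ⊕ Σ (λ j → f (punchIn i j))
      ≈⟨ +-congˡ (Σ-zero _ λ j → f≃0 (punchIn i j) (Fin.punchInᵢ≢i i j ∘ ≡.sym)) ⟩
    f i ⊕ 0#                       ≈⟨ +-identityʳ (f i) ⟩
    f i                            ∎

  Σ-mono : ∀ {n} (f g : Vector Carrier n) → (∀ i → f i ≲ g i) → Σ f ≲ Σ g
  Σ-mono {zero}  f g f≲g = ≲-refl
  Σ-mono {suc n} f g f≲g = +-mono-≲ (f≲g zero) (Σ-mono (f ∘ suc) (g ∘ suc) (f≲g ∘ suc))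

  Σ-nonneg : ∀ {n} (f : Vector Carrier n) → (∀ i → 0# ≲ f i) → 0# ≲ Σ f
  Σ-nonneg {n} f 0≲f = ≲-trans (≲-reflexive (sym (sum-replicate-zero n))) (Σ-mono _ f 0≲f)

  -- The product axiom concerns nonnegative factors only, so it is applied to `x` and the difference
  -- z - y; then `x ⊗ y` is added back.
  *-monoˡ-≲ : ∀ {x y z} → 0# ≲ x → y ≲ z → x ⊗ y ≲ x ⊗ z
  *-monoˡ-≲ {x} {y} {z} 0≲x y≲z = begin
    x ⊗ y                      ≈⟨ +-identityˡ _ ⟨
    0# ⊕ x ⊗ y                 ≲⟨ +-mono-≲ (*-nonneg 0≲x 0≲z-y) ≲-refl ⟩
    x ⊗ (z ⊕ ⊝ y) ⊕ x ⊗ y      ≈⟨ distribˡ x _ y ⟨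
    x ⊗ ((z ⊕ ⊝ y) ⊕ y)        ≈⟨ *-congˡ (trans (+-assoc z (⊝ y) y)
                                    (trans (+-congˡ (-‿inverseˡ y)) (+-identityʳ z))) ⟩
    x ⊗ z                      ∎
    where
    0≲z-y : 0# ≲ z ⊕ ⊝ y
    0≲z-y = ≲-trans (≲-reflexive (sym (-‿inverseʳ y))) (+-mono-≲ y≲z ≲-refl)

  -- Here `ρ` acts as 1/y. This turns eᵀPe ≤ tr P · ϑ into the bound on the quotient.
  quotient-≲ : ∀ {x y z ρ} → 0# ≲ ρ → ρ ⊗ y ≃ 1# → x ≲ y ⊗ z → x ⊗ ρ ≲ z
  quotient-≲ {x} {y} {z} {ρ} 0≲ρ ρy≃1 x≲yz = begin
    x ⊗ ρ         ≈⟨ *-comm x ρ ⟩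
    ρ ⊗ x         ≲⟨ *-monoˡ-≲ 0≲ρ x≲yz ⟩
    ρ ⊗ (y ⊗ z)   ≈⟨ *-assoc ρ y z ⟨
    ρ ⊗ y ⊗ z     ≈⟨ *-congʳ ρy≃1 ⟩
    1# ⊗ z        ≈⟨ *-identityˡ z ⟩
    z             ∎

  Σ-scale : ∀ {n} (f : Vector Carrier n) ρ → Σ (λ i → f i ⊗ ρ) ≃ Σ f ⊗ ρ
  Σ-scale f ρ = sym (*-distribʳ-sum ρ f)

  quadratic-scale : ∀ {n} (P Q : Fin n → Fin n → Carrier) ρ → (∀ i j → Q i j ≃ P i j ⊗ ρ) →
                    ∀ x → quadratic Q x ≃ quadratic P x ⊗ ρ
  quadratic-scale {n} P Q ρ Q≃Pρ x = begin-equality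
    Σ (λ i → x i ⊗ Σ λ j → Q i j ⊗ x j)
      ≈⟨ sum-cong-≋ {n} (λ i → *-congˡ (sum-cong-≋ {n} λ j → trans (*-congʳ (Q≃Pρ i j))
           (trans (*-assoc _ _ _) (trans (*-congˡ (*-comm _ _)) (sym (*-assoc _ _ _)))))) ⟩
    Σ (λ i → x i ⊗ Σ λ j → P i j ⊗ x j ⊗ ρ)
      ≈⟨ sum-cong-≋ {n} (λ i → trans (*-congˡ (Σ-scale {n} _ ρ)) (sym (*-assoc _ _ _))) ⟩
    Σ (λ i → x i ⊗ (P i · x) ⊗ ρ)
      ≈⟨ Σ-scale {n} _ ρ ⟩
    quadratic P x ⊗ ρ ∎

  basis : ∀ {n} → Fin n → Vector Carrier n
  basis i j with i Fin.≟ j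
  ... | yes _ = 1#
  ... | no  _ = 0#

  basis-diagonal : ∀ {n} (i : Fin n) → basis i i ≃ 1#
  basis-diagonal i with i Fin.≟ i
  ... | yes _  = refl
  ... | no i≢i = contradiction ≡.refl i≢i

  basis-offDiagonal : ∀ {n} {i j : Fin n} → i ≢ j → basis i j ≃ 0#
  basis-offDiagonal {i = i} {j} i≢j with i Fin.≟ j
  ... | yes i≡j = contradiction i≡j i≢j
  ... | no  _   = refl

  -- The quadratic form takes the value `P i i` at the `i`-th standard basis vector.
  diagonal-nonneg : ∀ {n} (P : Fin n → Fin n → Carrier) →
                    (∀ x → 0# ≲ quadratic P x) → ∀ i → 0# ≲ P i i
  diagonal-nonneg P psd i = ≲-trans (psd (basis i)) (≲-reflexive (begin-equality
    quadratic P (basis i)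
      ≈⟨ Σ-single _ i (λ j i≢j → *-zero-factorˡ _ _ (basis-offDiagonal i≢j)) ⟩
    basis i i ⊗ (P i · basis i)
      ≈⟨ trans (*-congʳ (basis-diagonal i)) (*-identityˡ _) ⟩
    P i · basis i
      ≈⟨ Σ-single _ i (λ j i≢j → *-zero-factorʳ _ _ (basis-offDiagonal i≢j)) ⟩
    P i i ⊗ basis i i
      ≈⟨ trans (*-congˡ (basis-diagonal i)) (*-identityʳ _) ⟩
    P i i ∎))

  ·-distribʳ-+ : ∀ {m} (x y z : Vector Carrier m) → (λ a → x a ⊕ y a) · z ≃ x · z ⊕ y · z
  ·-distribʳ-+ {m} x y z =
    trans (sum-cong-≋ {m} λ a → distribʳ (z a) (x a) (y a)) (∑-distrib-+ {m} _ _)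

  ·-comm : ∀ {m} (x y : Vector Carrier m) → x · y ≃ y · x
  ·-comm x y = sum-cong-≋ λ a → *-comm (x a) (y a)

  ·-scaleˡ : ∀ {m} s (x y : Vector Carrier m) → (λ a → s ⊗ x a) · y ≃ s ⊗ (x · y)
  ·-scaleˡ {m} s x y =
    trans (sum-cong-≋ {m} λ a → *-assoc s (x a) (y a)) (sym (*-distribˡ-sum {m} s _))

  -- Bilinearity. It is used with `c` a unit vector and `s`, `t` such that s(c·x) = t(c·y) = -1,
  -- where all terms but the last add up to -1.
  shifted-· : ∀ {m} (c x y : Vector Carrier m) s t →
              (λ a → c a ⊕ s ⊗ x a) · (λ a → c a ⊕ t ⊗ y a) ≃
              (c · c ⊕ t ⊗ (c · y)) ⊕ (s ⊗ (c · x) ⊕ s ⊗ t ⊗ (x · y))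
  shifted-· c x y s t = trans (·-distribʳ-+ c _ _) (+-cong (right c) (begin-equality
    (λ a → s ⊗ x a) · v                     ≈⟨ ·-scaleˡ s x v ⟩
    s ⊗ (x · v)                             ≈⟨ *-congˡ (right x) ⟩
    s ⊗ (x · c ⊕ t ⊗ (x · y))               ≈⟨ distribˡ _ _ _ ⟩
    s ⊗ (x · c) ⊕ s ⊗ (t ⊗ (x · y))         ≈⟨ +-cong (*-congˡ (·-comm x c)) (sym (*-assoc _ _ _)) ⟩
    s ⊗ (c · x) ⊕ s ⊗ t ⊗ (x · y)           ∎))
    where
    v = λ a → c a ⊕ t ⊗ y a

    right : ∀ z → z · v ≃ z · c ⊕ t ⊗ (z · y)
    right z = begin-equality
      z · v                          ≈⟨ ·-comm z v ⟩
      v · z                          ≈⟨ ·-distribʳ-+ c _ z ⟩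
      c · z ⊕ (λ a → t ⊗ y a) · z    ≈⟨ +-cong (·-comm c z) (·-scaleˡ t y z) ⟩
      z · c ⊕ t ⊗ (y · z)            ≈⟨ +-congˡ (*-congˡ (·-comm y z)) ⟩
      z · c ⊕ t ⊗ (z · y)            ∎

  -- The right side pairs `P` with the Gram matrix of the `v i`. Writing it as a sum over
  -- coordinates shows it nonnegative for positive semidefinite `P`, without factoring `P`.
  Σ-quadratic : ∀ {n m} (P : Fin n → Fin n → Carrier) (v : Fin n → Vector Carrier m) →
                Σ (λ a → quadratic P (λ i → v i a)) ≃ Σ λ i → Σ λ j → P i j ⊗ (v i · v j)
  Σ-quadratic {n} {m} P v = begin-equality
    Σ (λ a → Σ λ i → v i a ⊗ Σ λ j → P i j ⊗ v j a)
      ≈⟨ ∑-comm (λ a i → v i a ⊗ Σ λ j → P i j ⊗ v j a) ⟩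
    Σ (λ i → Σ λ a → v i a ⊗ Σ λ j → P i j ⊗ v j a)
      ≈⟨ sum-cong-≋ (λ i → sum-cong-≋ λ a →
           trans (*-distribˡ-sum {n} (v i a) _) (sum-cong-≋ {n} λ j → x∙yz≈y∙xz (v i a) _ _)) ⟩
    Σ (λ i → Σ λ a → Σ λ j → P i j ⊗ (v i a ⊗ v j a))
      ≈⟨ sum-cong-≋ (λ i → ∑-comm (λ a j → P i j ⊗ (v i a ⊗ v j a))) ⟩
    Σ (λ i → Σ λ j → Σ λ a → P i j ⊗ (v i a ⊗ v j a))
      ≈⟨ sum-cong-≋ (λ i → sum-cong-≋ λ j → sym (*-distribˡ-sum {m} (P i j) _)) ⟩
    Σ (λ i → Σ λ j → P i j ⊗ (v i · v j)) ∎

  -- Weak duality for an orthonormal representation.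

  module _ {n m} (P : Fin n → Fin n → Carrier) (psd : ∀ x → 0# ≲ quadratic P x)
    (u : Fin n → Vector Carrier m) (c : Vector Carrier m) (r : Fin n → Carrier) (t : Carrier)
    (unit-u : ∀ i → u i · u i ≃ 1#) (unit-c : c · c ≃ 1#)
    -- Either factor may be the one that vanishes: `P i j` on edges, the inner product on nonedges.
    (orthogonal : ∀ i j → i ≢ j → P i j ⊗ (u i · u j) ≃ 0#)
    (r-recip : ∀ i → r i ⊗ ((c · u i) ⊗ (c · u i)) ≃ 1#)
    (r≲t : ∀ i → r i ≲ t)
    where

    private

      -- -1/(c·uᵢ), obtained from the given reciprocal of (c·uᵢ)².
      s : Fin n → Carrier
      s i = ⊝ (r i ⊗ (c · u i))

      v : Fin n → Vector Carrier m
      v i a = c a ⊕ s i ⊗ u i a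

      s-recip : ∀ i → s i ⊗ (c · u i) ≃ ⊝ 1#
      s-recip i = trans (sym (-‿distribˡ-* _ _))
        (-‿cong (trans (*-assoc _ _ _) (r-recip i)))

      s²≃r : ∀ i → s i ⊗ s i ≃ r i
      s²≃r i = begin-equality
        s i ⊗ s i                            ≈⟨ -‿distribʳ-* _ _ ⟨
        ⊝ (s i ⊗ (r i ⊗ (c · u i)))          ≈⟨ -‿cong (x∙yz≈y∙xz _ _ _) ⟩
        ⊝ (r i ⊗ (s i ⊗ (c · u i)))          ≈⟨ -‿cong (*-congˡ (s-recip i)) ⟩
        ⊝ (r i ⊗ ⊝ 1#)                       ≈⟨ -‿cong (-‿distribʳ-* _ _) ⟨
        ⊝ ⊝ (r i ⊗ 1#)                       ≈⟨ -‿involutive _ ⟩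
        r i ⊗ 1#                             ≈⟨ *-identityʳ _ ⟩
        r i                                  ∎

      -- The 1 stays on the left because the Gram matrix plus the all-ones matrix is what `P` is
      -- paired with in `row`.
      v·v : ∀ i j → v i · v j ⊕ 1# ≃ s i ⊗ s j ⊗ (u i · u j)
      v·v i j = begin-equality
        v i · v j ⊕ 1#
          ≈⟨ +-congʳ (shifted-· c (u i) (u j) (s i) (s j)) ⟩
        ((c · c ⊕ s j ⊗ (c · u j)) ⊕ (s i ⊗ (c · u i) ⊕ z)) ⊕ 1#
          ≈⟨ +-congʳ (+-cong (+-cong unit-c (s-recip j)) (+-congʳ (s-recip i))) ⟩
        ((1# ⊕ ⊝ 1#) ⊕ (⊝ 1# ⊕ z)) ⊕ 1#
          ≈⟨ +-congʳ (trans (+-congʳ (-‿inverseʳ 1#)) (+-identityˡ _)) ⟩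
        (⊝ 1# ⊕ z) ⊕ 1#
          ≈⟨ trans (+-comm _ _) (sym (+-assoc _ _ _)) ⟩
        (1# ⊕ ⊝ 1#) ⊕ z
          ≈⟨ trans (+-congʳ (-‿inverseʳ 1#)) (+-identityˡ z) ⟩
        z ∎
        where z = s i ⊗ s j ⊗ (u i · u j)

      -- Orthogonality kills every term with j ≠ i; on the diagonal `s i ⊗ s i` is `r i` and `u i`
      -- is a unit vector.
      row : ∀ i → Σ (λ j → P i j ⊗ (v i · v j) ⊕ P i j) ≃ P i i ⊗ r i
      row i = begin-equality
        Σ (λ j → P i j ⊗ (v i · v j) ⊕ P i j)
          ≈⟨ sum-cong-≋ (λ j → trans (+-congˡ (sym (*-identityʳ _)))
               (trans (sym (distribˡ _ _ _)) (*-congˡ (v·v i j)))) ⟩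
        Σ (λ j → P i j ⊗ (s i ⊗ s j ⊗ (u i · u j)))
          ≈⟨ Σ-single _ i (λ j i≢j → trans (x∙yz≈y∙xz _ _ _)
               (*-zero-factorʳ _ _ (orthogonal i j i≢j))) ⟩
        P i i ⊗ (s i ⊗ s i ⊗ (u i · u i))
          ≈⟨ *-congˡ (trans (*-cong (s²≃r i) (unit-u i)) (*-identityʳ _)) ⟩
        P i i ⊗ r i ∎

    weak-duality : Σ (λ i → Σ λ j → P i j) ≲ Σ (λ i → P i i) ⊗ t
    weak-duality = begin
      Σ (λ i → Σ λ j → P i j)
        ≈⟨ +-identityˡ _ ⟨
      0# ⊕ Σ (λ i → Σ λ j → P i j)
        -- The nonnegative Gram pairing inserted here is what completes each row sum of `P` to
        -- `P i i ⊗ r i`.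
        ≲⟨ +-mono-≲ (Σ-nonneg _ λ a → psd λ i → v i a) ≲-refl ⟩
      Σ (λ a → quadratic P (λ i → v i a)) ⊕ Σ (λ i → Σ λ j → P i j)
        ≈⟨ +-congʳ (Σ-quadratic P v) ⟩
      Σ (λ i → Σ λ j → P i j ⊗ (v i · v j)) ⊕ Σ (λ i → Σ λ j → P i j)
        ≈⟨ trans (sum-cong-≋ {n} λ i → ∑-distrib-+ {n} _ _) (∑-distrib-+ {n} _ _) ⟨
      Σ (λ i → Σ λ j → P i j ⊗ (v i · v j) ⊕ P i j)
        ≈⟨ sum-cong-≋ row ⟩
      Σ (λ i → P i i ⊗ r i)
        ≲⟨ Σ-mono _ _ (λ i → *-monoˡ-≲ (diagonal-nonneg P psd i) (r≲t i)) ⟩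
      Σ (λ i → P i i ⊗ t)
        ≈⟨ Σ-scale {n} _ t ⟩
      Σ (λ i → P i i) ⊗ t ∎

-- Null sequences of rationals.

Null : (ℕ → ℚ) → Set
Null f = ∀ ε → 0ℚ ℚ.< ε → Eventually λ n → ℚ.∣ f n ∣ ℚ.< ε

eventually-zip : ∀ {P Q R : ℕ → Set} → (∀ {n} → P n → Q n → R n) →
                 Eventually P → Eventually Q → Eventually R
eventually-zip f (M , p) (N , q) = M ℕ.⊔ N , λ n n≥ →
  f (p n (ℕ.m⊔n≤o⇒m≤o M N n≥)) (q n (ℕ.m⊔n≤o⇒n≤o M N n≥))

eventually-map : ∀ {P Q : ℕ → Set} → (∀ {n} → P n → Q n) → Eventually P → Eventually Q
eventually-map f (N , p) = N , λ n n≥ → f (p n n≥)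

always : ∀ {P : ℕ → Set} → (∀ n → P n) → Eventually P
always p = 0 , λ n _ → p n

null-resp : ∀ {f g} → f ≗ g → Null f → Null g
null-resp f≗g null ε 0<ε =
  eventually-map (λ {n} → ≡.subst (λ p → ℚ.∣ p ∣ ℚ.< ε) (f≗g n)) (null ε 0<ε)

-- Vanishing is asked only from some index on: the early terms of a real apart from zero may be 0,
-- where `invℚ` returns its default value.
null-zero : ∀ {f} → Eventually (λ n → f n ≡ 0ℚ) → Null f
null-zero f≡0 ε 0<ε = eventually-map (λ eq → ≡.subst (ℚ._< ε) (≡.sym (≡.cong ℚ.∣_∣ eq)) 0<ε) f≡0

null-+ : ∀ {f g} → Null f → Null g → Null (λ n → f n ℚ.+ g n)
null-+ {f} {g} null-f null-g ε 0<ε = eventually-zip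
  (λ {n} ∣f∣< ∣g∣< → ℚ.≤-<-trans (ℚ.∣p+q∣≤∣p∣+∣q∣ (f n) (g n))
    (≡.subst (ℚ.∣ f n ∣ ℚ.+ ℚ.∣ g n ∣ ℚ.<_) (half+half ε) (ℚ.+-mono-< ∣f∣< ∣g∣<)))
  (null-f (½ ℚ.* ε) (half-pos 0<ε)) (null-g (½ ℚ.* ε) (half-pos 0<ε))

null-neg : ∀ {f} → Null f → Null (λ n → ℚ.- f n)
null-neg {f} null ε 0<ε =
  eventually-map (λ {n} → ≡.subst (ℚ._< ε) (≡.sym (ℚ.∣-p∣≡∣p∣ (f n)))) (null ε 0<ε)

-- Take δ = ε/(1 + K), so that Kδ < δ + Kδ = ε. The 1 keeps the divisor positive when `K` is 0.
shrink : ∀ {K ε} → 0ℚ ℚ.≤ K → 0ℚ ℚ.< ε → ∃ λ δ → 0ℚ ℚ.< δ × K ℚ.* δ ℚ.< ε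
shrink {K} {ε} 0≤K 0<ε = δ , 0<δ , ≡.subst₂ ℚ._<_ (ℚ.+-identityˡ _) sum≡ε
  (ℚ.+-monoˡ-< (K ℚ.* δ) 0<δ)
  where
  inverse = positive-inverse (ℚ.+-mono-<-≤ (ℚ.positive⁻¹ 1ℚ) 0≤K)
  I = proj₁ inverse
  δ = I ℚ.* ε

  0<δ : 0ℚ ℚ.< δ
  0<δ = *-pos (proj₁ (proj₂ inverse)) 0<ε

  regroup : ∀ K I ε → I ℚ.* ε ℚ.+ K ℚ.* (I ℚ.* ε) ≡ (I ℚ.* (1ℚ ℚ.+ K)) ℚ.* ε
  regroup = solve 3 (λ K I ε → I :* ε :+ K :* (I :* ε) := (I :* (con 1ℚ :+ K)) :* ε) ≡.refl
    where open +-*-Solver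

  sum≡ε : δ ℚ.+ K ℚ.* δ ≡ ε
  sum≡ε = ≡.trans (regroup K I ε)
    (≡.trans (≡.cong (ℚ._* ε) (proj₂ (proj₂ inverse))) (ℚ.*-identityˡ ε))

-- The first factor is a real because Cauchy sequences are eventually bounded; `shrink` then absorbs
-- the bound.
null-* : ∀ x {f} → Null f → Null (λ n → seq x n ℚ.* f n)
null-* x {f} null ε 0<ε = eventually-zip
  (λ {n} ∣x∣≤K ∣f∣<δ → begin-strict
    ℚ.∣ seq x n ℚ.* f n ∣            ≡⟨ ℚ.∣p*q∣≡∣p∣*∣q∣ (seq x n) (f n) ⟩
    ℚ.∣ seq x n ∣ ℚ.* ℚ.∣ f n ∣      ≤⟨ *-mono-≤ 0≤∣ seq x n ∣ (ℚ.<⇒≤ 0<δ) ∣x∣≤K (ℚ.<⇒≤ ∣f∣<δ) ⟩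
    K ℚ.* δ                          <⟨ Kδ<ε ⟩
    ε                                ∎)
  ∣x∣≤K (null δ 0<δ)
  where
  open ℚ.≤-Reasoning
  bounded = eventually-bounded x
  K = proj₁ bounded
  ∣x∣≤K = proj₂ (proj₂ bounded)
  small = shrink (proj₁ (proj₂ bounded)) 0<ε
  δ = proj₁ small
  0<δ = proj₁ (proj₂ small)
  Kδ<ε = proj₂ (proj₂ small)

-- x ≈ y and x ≤ y unfold to function types, from which x and y cannot be
-- inferred; hence the explicit arguments below.

pointwise : ∀ x y → seq x ≗ seq y → x ≈ y
pointwise x y x≗y = null-zero (always λ n →
  ≡.trans (≡.cong (ℚ._- seq y n) (x≗y n)) (ℚ.+-inverseʳ (seq y n)))

≈-refl : ∀ x → x ≈ x
≈-refl x = pointwise x x λ _ → ≡.refl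

≈-sym : ∀ x y → x ≈ y → y ≈ x
≈-sym x y x≈y = null-resp (λ n → regroup (seq x n) (seq y n))
  (null-neg x≈y)
  where
  open +-*-Solver
  regroup : ∀ a b → ℚ.- (a ℚ.- b) ≡ b ℚ.- a
  regroup = solve 2 (λ a b → :- (a :- b) := b :- a) ≡.refl

≈-trans : ∀ x y z → x ≈ y → y ≈ z → x ≈ z
≈-trans x y z x≈y y≈z = null-resp
  (λ n → regroup (seq x n) (seq y n) (seq z n)) (null-+ x≈y y≈z)
  where
  open +-*-Solver
  regroup : ∀ a b c → (a ℚ.- b) ℚ.+ (b ℚ.- c) ≡ a ℚ.- c
  regroup = solve 3 (λ a b c → (a :- b) :+ (b :- c) := a :- c) ≡.refl

+-cong : ∀ w x y z → w ≈ x → y ≈ z → w + y ≈ x + z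
+-cong w x y z w≈x y≈z = null-resp
  (λ n → regroup (seq w n) (seq x n) (seq y n) (seq z n)) (null-+ w≈x y≈z)
  where
  open +-*-Solver
  regroup : ∀ a b c d → (a ℚ.- b) ℚ.+ (c ℚ.- d) ≡ (a ℚ.+ c) ℚ.- (b ℚ.+ d)
  regroup = solve 4 (λ a b c d → (a :- b) :+ (c :- d) := (a :+ c) :- (b :+ d)) ≡.refl

*-cong : ∀ w x y z → w ≈ x → y ≈ z → w * y ≈ x * z
*-cong w x y z w≈x y≈z = null-resp
  (λ n → regroup (seq w n) (seq x n) (seq y n) (seq z n))
  (null-+ (null-* w y≈z) (null-* z w≈x))
  where
  open +-*-Solver
  regroup : ∀ a b c d → a ℚ.* (c ℚ.- d) ℚ.+ d ℚ.* (a ℚ.- b) ≡ a ℚ.* c ℚ.- b ℚ.* d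
  regroup = solve 4 (λ a b c d →
    a :* (c :- d) :+ d :* (a :- b) := a :* c :- b :* d) ≡.refl

-_ : ℝ → ℝ
- x = mkℝ (λ n → ℚ.- seq x n) λ ε 0<ε →
  let N , close = cauchy x ε 0<ε
  in N , λ m n m≥ n≥ → ≡.subst (ℚ._< ε)
       (≡.trans (≡.sym (ℚ.∣-p∣≡∣p∣ (seq x m ℚ.- seq x n)))
         (≡.cong ℚ.∣_∣ (ℚ.neg-distrib-+ (seq x m) (ℚ.- seq x n))))
       (close m n m≥ n≥)

neg-cong : ∀ x y → x ≈ y → - x ≈ - y
neg-cong x y x≈y = null-resp
  (λ n → ℚ.neg-distrib-+ (seq x n) (ℚ.- seq y n)) (null-neg x≈y)

-- The algebraic laws hold termwise in the rationals and come from `pointwise`; symmetry,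
-- transitivity and the congruences come from null sequences.
ℝ-commutativeRing : CommutativeRing 0ℓ 0ℓ
ℝ-commutativeRing = record
  { Carrier = ℝ ; _≈_ = _≈_ ; _+_ = _+_ ; _*_ = _*_ ; -_ = -_ ; 0# = 0ℝ ; 1# = 1ℝ
  ; isCommutativeRing = record
    { isRing = record
      { +-isAbelianGroup = record
        { isGroup = record
          { isMonoid = record
            { isSemigroup = record
              { isMagma = record
                { isEquivalence = record
                  { refl  = λ {x} → ≈-refl x
                  ; sym   = λ {x} {y} → ≈-sym x y
                  ; trans = λ {x} {y} {z} → ≈-trans x y z
                  }
                ; ∙-cong = λ {w} {x} {y} {z} → +-cong w x y z
                }
              ; assoc = λ x y z → pointwise (x + y + z) (x + (y + z)) λ n →
                  ℚ.+-assoc (seq x n) (seq y n) (seq z n)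
              }
            ; identity = (λ x → pointwise (0ℝ + x) x λ n → ℚ.+-identityˡ (seq x n))
                       , (λ x → pointwise (x + 0ℝ) x λ n → ℚ.+-identityʳ (seq x n))
            }
          ; inverse = (λ x → pointwise (- x + x) 0ℝ λ n → ℚ.+-inverseˡ (seq x n))
                    , (λ x → pointwise (x + - x) 0ℝ λ n → ℚ.+-inverseʳ (seq x n))
          ; ⁻¹-cong = λ {x} {y} → neg-cong x y
          }
        ; comm = λ x y → pointwise (x + y) (y + x) λ n → ℚ.+-comm (seq x n) (seq y n)
        }
      ; *-cong     = λ {w} {x} {y} {z} → *-cong w x y z
      ; *-assoc    = λ x y z → pointwise (x * y * z) (x * (y * z)) λ n →
          ℚ.*-assoc (seq x n) (seq y n) (seq z n)
      ; *-identity = (λ x → pointwise (1ℝ * x) x λ n → ℚ.*-identityˡ (seq x n))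
                   , (λ x → pointwise (x * 1ℝ) x λ n → ℚ.*-identityʳ (seq x n))
      ; distrib    = (λ x y z → pointwise (x * (y + z)) (x * y + x * z) λ n →
                       ℚ.*-distribˡ-+ (seq x n) (seq y n) (seq z n))
                   , (λ x y z → pointwise ((y + z) * x) (y * x + z * x) λ n →
                       ℚ.*-distribʳ-+ (seq x n) (seq y n) (seq z n))
      }
    ; *-comm = λ x y → pointwise (x * y) (y * x) λ n → ℚ.*-comm (seq x n) (seq y n)
    }
  }

-- The order on the reals.

≤-reflexive : ∀ x y → x ≈ y → x ≤ y
≤-reflexive x y x≈y ε 0<ε = eventually-map
  (λ {n} close → ≡.subst₂ ℚ._<_ (regroup (seq x n) (seq y n)) (ℚ.+-comm ε (seq y n))
    (ℚ.+-monoˡ-< (seq y n) (ℚ.≤-<-trans (p≤∣p∣ _) close)))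
  (x≈y ε 0<ε)
  where
  open +-*-Solver
  regroup : ∀ a b → (a ℚ.- b) ℚ.+ b ≡ a
  regroup = solve 2 (λ a b → (a :- b) :+ b := a) ≡.refl

≤-trans : ∀ x y z → x ≤ y → y ≤ z → x ≤ z
≤-trans x y z x≤y y≤z ε 0<ε = eventually-zip
  (λ {n} x< y< → ≡.subst (seq x n ℚ.<_)
    (≡.trans (ℚ.+-assoc (seq z n) _ _) (≡.cong (seq z n ℚ.+_) (half+half ε)))
    (ℚ.<-trans x< (ℚ.+-monoˡ-< (½ ℚ.* ε) y<)))
  (x≤y (½ ℚ.* ε) (half-pos 0<ε)) (y≤z (½ ℚ.* ε) (half-pos 0<ε))

+-mono-≤ : ∀ w x y z → w ≤ x → y ≤ z → w + y ≤ x + z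
+-mono-≤ w x y z w≤x y≤z ε 0<ε = eventually-zip
  (λ {n} w< y< → ≡.subst (seq w n ℚ.+ seq y n ℚ.<_)
    (≡.trans (regroup (seq x n) (seq z n) (½ ℚ.* ε))
      (≡.cong (seq x n ℚ.+ seq z n ℚ.+_) (half+half ε)))
    (ℚ.+-mono-< w< y<))
  (w≤x (½ ℚ.* ε) (half-pos 0<ε)) (y≤z (½ ℚ.* ε) (half-pos 0<ε))
  where
  open +-*-Solver
  regroup : ∀ a b c → (a ℚ.+ c) ℚ.+ (b ℚ.+ c) ≡ (a ℚ.+ b) ℚ.+ (c ℚ.+ c)
  regroup = solve 3 (λ a b c → (a :+ c) :+ (b :+ c) := (a :+ b) :+ (c :+ c)) ≡.refl

-- Terms of a nonnegative real may dip below 0, hence the slack Kδ. For y ≥ 0, expand (x + δ)y ≥ 0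
-- and use y ≤ K; for y ≤ 0, start from K(y + δ) ≥ 0 and use that multiplying x ≤ K by `y` reverses
-- it.
0≤*-approx : ∀ {x y K δ} → x ℚ.≤ K → y ℚ.≤ K → 0ℚ ℚ.≤ K →
             0ℚ ℚ.≤ x ℚ.+ δ → 0ℚ ℚ.≤ y ℚ.+ δ → 0ℚ ℚ.≤ δ → 0ℚ ℚ.≤ x ℚ.* y ℚ.+ K ℚ.* δ
0≤*-approx {x} {y} {K} {δ} x≤K y≤K 0≤K 0≤x+δ 0≤y+δ 0≤δ with ℚ.≤-total 0ℚ y
... | inj₁ 0≤y = begin
  0ℚ                      ≡⟨ ℚ.*-zeroʳ (x ℚ.+ δ) ⟨
  (x ℚ.+ δ) ℚ.* 0ℚ        ≤⟨ ℚ.*-monoˡ-≤-nonNeg (x ℚ.+ δ) {{ℚ.nonNegative 0≤x+δ}} 0≤y ⟩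
  (x ℚ.+ δ) ℚ.* y         ≡⟨ ℚ.*-distribʳ-+ y x δ ⟩
  x ℚ.* y ℚ.+ δ ℚ.* y     ≡⟨ ≡.cong (x ℚ.* y ℚ.+_) (ℚ.*-comm δ y) ⟩
  x ℚ.* y ℚ.+ y ℚ.* δ     ≤⟨ ℚ.+-monoʳ-≤ (x ℚ.* y) (ℚ.*-monoʳ-≤-nonNeg δ {{ℚ.nonNegative 0≤δ}} y≤K) ⟩
  x ℚ.* y ℚ.+ K ℚ.* δ     ∎
  where open ℚ.≤-Reasoning
... | inj₂ y≤0 = begin
  0ℚ                      ≡⟨ ℚ.*-zeroʳ K ⟨
  K ℚ.* 0ℚ                ≤⟨ ℚ.*-monoˡ-≤-nonNeg K {{ℚ.nonNegative 0≤K}} 0≤y+δ ⟩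
  K ℚ.* (y ℚ.+ δ)         ≡⟨ ℚ.*-distribˡ-+ K y δ ⟩
  K ℚ.* y ℚ.+ K ℚ.* δ     ≤⟨ ℚ.+-monoˡ-≤ (K ℚ.* δ) (ℚ.*-monoʳ-≤-nonPos y {{ℚ.nonPositive y≤0}} x≤K) ⟩
  x ℚ.* y ℚ.+ K ℚ.* δ     ∎
  where open ℚ.≤-Reasoning

*-nonneg-ℝ : ∀ x y → 0ℝ ≤ x → 0ℝ ≤ y → 0ℝ ≤ x * y
*-nonneg-ℝ x y 0≤x 0≤y ε 0<ε = eventually-zip
  (λ {n} (∣x∣≤ , ∣y∣≤) (0<x+δ , 0<y+δ) → ℚ.≤-<-trans
    (0≤*-approx (bound ∣x∣≤ Kx≤K) (bound ∣y∣≤ Ky≤K) 0≤K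
      (ℚ.<⇒≤ 0<x+δ) (ℚ.<⇒≤ 0<y+δ) (ℚ.<⇒≤ 0<δ))
    (ℚ.+-monoʳ-< (seq x n ℚ.* seq y n) Kδ<ε))
  (eventually-zip _,_ (proj₂ (proj₂ bounded-x)) (proj₂ (proj₂ bounded-y)))
  (eventually-zip _,_ (0≤x δ 0<δ) (0≤y δ 0<δ))
  where
  bounded-x = eventually-bounded x
  bounded-y = eventually-bounded y
  Kx = proj₁ bounded-x
  Ky = proj₁ bounded-y
  K = Kx ℚ.+ Ky
  0≤Kx = proj₁ (proj₂ bounded-x)
  0≤Ky = proj₁ (proj₂ bounded-y)

  0≤K : 0ℚ ℚ.≤ K
  0≤K = ℚ.+-mono-≤ 0≤Kx 0≤Ky

  Kx≤K : Kx ℚ.≤ K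
  Kx≤K = ≡.subst (ℚ._≤ K) (ℚ.+-identityʳ Kx) (ℚ.+-monoʳ-≤ Kx 0≤Ky)

  Ky≤K : Ky ℚ.≤ K
  Ky≤K = ≡.subst (ℚ._≤ K) (ℚ.+-identityˡ Ky) (ℚ.+-monoˡ-≤ Ky 0≤Kx)

  bound : ∀ {p L} → ℚ.∣ p ∣ ℚ.≤ L → L ℚ.≤ K → p ℚ.≤ K
  bound {p} ∣p∣≤L L≤K = ℚ.≤-trans (p≤∣p∣ p) (ℚ.≤-trans ∣p∣≤L L≤K)

  small = shrink 0≤K 0<ε
  δ = proj₁ small
  0<δ = proj₁ (proj₂ small)
  Kδ<ε = proj₂ (proj₂ small)

ℝ-orderedRing : OrderedRing
ℝ-orderedRing = record
  { commutativeRing = ℝ-commutativeRing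
  ; _≲_             = _≤_
  ; ≲-isPreorder    = record
    { isEquivalence = CommutativeRing.isEquivalence ℝ-commutativeRing
    ; reflexive     = λ {x} {y} → ≤-reflexive x y
    ; trans         = λ {x} {y} {z} → ≤-trans x y z
    }
  ; +-mono-≲        = λ {w} {x} {y} {z} → +-mono-≤ w x y z
  ; *-nonneg        = λ {x} {y} → *-nonneg-ℝ x y
  }

module ℝₒ = OrderedRingProperties ℝ-orderedRing

-- Reciprocals of reals.

recip-inverseˡ : ∀ x (x#0 : x # 0ℝ) → recip x x#0 * x ≈ 1ℝ
recip-inverseˡ x x#0 = null-zero
  (eventually-map (λ {n} η≤ → ≡.cong (ℚ._- 1ℚ) (invℚ-inverseˡ λ xₙ≡0 →
      ℚ.<-irrefl ≡.refl (ℚ.<-≤-trans 0<η (≡.subst (_ ℚ.≤_) (≡.cong ℚ.∣_∣ xₙ≡0) η≤))))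
    (proj₂ (proj₂ away)))
  where
  away = away-from-0 x x#0
  0<η = proj₁ (proj₂ away)

invℚ-pos : ∀ {p} → 0ℚ ℚ.< p → 0ℚ ℚ.< invℚ p
invℚ-pos {p} 0<p with p ℚ.≟ 0ℚ
... | yes p≡0 = contradiction (≡.sym p≡0) (ℚ.<⇒≢ 0<p)
... | no p≢0  = ℚ.positive⁻¹ _ {{ℚ.1/pos⇒pos p {{ℚ.positive 0<p}}}}

recip-nonneg : ∀ x (0<x : 0ℝ < x) → 0ℝ ≤ recip x (inj₂ 0<x)
recip-nonneg x (ε , 0<ε , N , ε<x) η 0<η = N , λ n n≥ →
  -- The goal's left side `0ℚ` is matched with `0ℚ ℚ.+ 0ℚ` by computation.
  ℚ.+-mono-<
    (invℚ-pos (ℚ.<-trans 0<ε (≡.subst (ℚ._< seq x n) (ℚ.+-identityˡ ε) (ε<x n n≥)))) 0<η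

-- Walks, distances and the zero pattern of p(A).

module _ {n} (G : Graph n) where

  -- Descent on the length: since walks of a given length are decidable, either a shorter walk
  -- exists and replaces this one, or this one realizes the distance.
  walk⇒distance≤ : ∀ {k i j} d → d ℕ.≤ k → Walk G d i j → Distance≤ G k i j
  walk⇒distance≤ {k} {i} {j} = <-rec _ λ d shorten d≤k w →
    case d shorten d≤k w (ℕ.anyUpTo? (λ l → walk? G l i j) d)
    where
    case : ∀ d → (∀ {l} → l ℕ.< d → l ℕ.≤ k → Walk G l i j → Distance≤ G k i j) →
           d ℕ.≤ k → Walk G d i j → Dec (∃ λ l → l ℕ.< d × Walk G l i j) →
           Distance≤ G k i j
    case d shorten d≤k w (yes (l , l<d , v)) = shorten l<d (ℕ.≤-trans (ℕ.<⇒≤ l<d) d≤k) v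
    case d shorten d≤k w (no none) =
      d , d≤k , w , λ v → ℕ.≮⇒≥ λ l<d → none (_ , l<d , v)

  _++_ : ∀ {l m i j h} → Walk G l i j → Walk G m j h → Walk G (l ℕ.+ m) i h
  []      ++ w = w
  (e ∷ v) ++ w = e ∷ (v ++ w)

  -- All lengths up to `l` are excluded because a diagonal entry of `A` lets a factor stay in place.
  -- In each summand either `A i m` vanishes, or a walk of length at most 1 leads to `m` and would
  -- prolong any walk from `m` to `j`.
  power-zero : ∀ A → A ∈𝒮 G → ∀ l i j → (∀ d → d ℕ.≤ l → ¬ Walk G d i j) →
               (A ^ᴹ l) i j ≈ 0ℝ
  power-zero A A∈𝒮 zero i j far with i Fin.≟ j
  ... | yes ≡.refl = contradiction [] (far 0 ℕ.z≤n)
  ... | no _       = ≈-refl 0ℝ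
  power-zero A A∈𝒮 (suc l) i j far = ℝₒ.Σ-zero (λ m → A i m * (A ^ᴹ l) m j) term
    where
    term : ∀ m → A i m * (A ^ᴹ l) m j ≈ 0ℝ
    term m with distance≤? G 1 i m
    ... | no i≁m = ℝₒ.*-zero-factorˡ (A i m) ((A ^ᴹ l) m j) (proj₂ A∈𝒮 i m i≁m)
    ... | yes (d , d≤1 , v , _) = ℝₒ.*-zero-factorʳ (A i m) ((A ^ᴹ l) m j)
      (power-zero A A∈𝒮 l m j λ e e≤l w → far (d ℕ.+ e) (ℕ.+-mono-≤ d≤1 e≤l) (v ++ w))

  -- Exponents range over `Fin (suc k)`, so they are at most `k`, and a walk that short would put
  -- `j` within distance `k` of `i`.
  polynomial-zero : ∀ {k} A → A ∈𝒮 G → (p : Polynomial≤ k) → ∀ i j →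
                    ¬ Distance≤ G k i j → (p ⟦ A ⟧) i j ≈ 0ℝ
  polynomial-zero A A∈𝒮 p i j far = ℝₒ.Σ-zero (λ l → p l * (A ^ᴹ toℕ l) i j) λ l →
    ℝₒ.*-zero-factorʳ (p l) ((A ^ᴹ toℕ l) i j)
      (power-zero A A∈𝒮 (toℕ l) i j λ d d≤l w →
        far (walk⇒distance≤ d (ℕ.≤-trans d≤l (ℕ.s≤s⁻¹ (Fin.toℕ<n l))) w))

-- Not by reflexivity: comparing the summands of the two stuck sums makes Agda
-- unfold and compare the Cauchy moduli of nested products.
quadratic-≈ : ∀ {n} (P : Matrix n) x → x ∙ (P *ᵛ x) ≈ ℝₒ.quadratic P x
quadratic-≈ P x = ℝₒ.Σ-cong (λ i → x i * (P *ᵛ x) i) (λ i → x i * (P i ℝₒ.· x)) λ i →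
  *-cong (x i) (x i) ((P *ᵛ x) i) (P i ℝₒ.· x)
    (≈-refl (x i)) (≈-refl ((P *ᵛ x) i))

𝟏∙P𝟏≈entries : ∀ {n} (P : Matrix n) → 𝟏 ∙ (P *ᵛ 𝟏) ≈ sum λ i → sum (P i)
𝟏∙P𝟏≈entries P = ℝₒ.Σ-cong (λ i → 𝟏 i * (P *ᵛ 𝟏) i) (λ i → sum (P i)) λ i →
  ≈-trans (𝟏 i * (P *ᵛ 𝟏) i) ((P *ᵛ 𝟏) i) (sum (P i))
    (pointwise (𝟏 i * (P *ᵛ 𝟏) i) ((P *ᵛ 𝟏) i) λ n → ℚ.*-identityˡ (seq ((P *ᵛ 𝟏) i) n))
    (ℝₒ.Σ-cong (λ j → P i j * 𝟏 j) (P i) λ j →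
      pointwise (P i j * 𝟏 j) (P i j) λ n → ℚ.*-identityʳ (seq (P i j) n))

PSD⇒quadratic-nonneg : ∀ {n} (P : Matrix n) → PSD P → ∀ x → 0ℝ ≤ ℝₒ.quadratic P x
PSD⇒quadratic-nonneg P (_ , psd) x =
  ≤-trans 0ℝ (x ∙ (P *ᵛ x)) (ℝₒ.quadratic P x) (psd x)
    (≤-reflexive (x ∙ (P *ᵛ x)) (ℝₒ.quadratic P x) (quadratic-≈ P x))

-- Merges the conditions on edges and on nonedges into the single product condition of
-- `weak-duality`.
*-zero-dec : ∀ {Q : Set} x y → Dec Q → (Q → x ≈ 0ℝ) → (¬ Q → y ≈ 0ℝ) → x * y ≈ 0ℝ
*-zero-dec x y (yes q) x≈0 y≈0 = ℝₒ.*-zero-factorˡ x y (x≈0 q)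
*-zero-dec x y (no ¬q) x≈0 y≈0 = ℝₒ.*-zero-factorʳ x y (y≈0 ¬q)

-- Scaling positive semidefinite matrices.

scale : ∀ {n} → ℝ → Matrix n → Matrix n
scale ρ P i j = P i j * ρ

scale-quadratic : ∀ {n} ρ (P : Matrix n) x → x ∙ (scale ρ P *ᵛ x) ≈ (x ∙ (P *ᵛ x)) * ρ
scale-quadratic ρ P x =
  ≈-trans (x ∙ (scale ρ P *ᵛ x)) (ℝₒ.quadratic (scale ρ P) x) ((x ∙ (P *ᵛ x)) * ρ)
    (quadratic-≈ (scale ρ P) x)
    (≈-trans (ℝₒ.quadratic (scale ρ P) x) (ℝₒ.quadratic P x * ρ) ((x ∙ (P *ᵛ x)) * ρ)
      (ℝₒ.quadratic-scale P (scale ρ P) ρ (λ i j → ≈-refl (P i j * ρ)) x)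
      (*-cong (ℝₒ.quadratic P x) (x ∙ (P *ᵛ x)) ρ ρ
        (≈-sym (x ∙ (P *ᵛ x)) (ℝₒ.quadratic P x) (quadratic-≈ P x)) (≈-refl ρ)))

scale-PSD : ∀ {n} ρ (P : Matrix n) → 0ℝ ≤ ρ → PSD P → PSD (scale ρ P)
scale-PSD ρ P 0≤ρ (P-sym , psd) =
  (λ i j → *-cong (P i j) (P j i) ρ ρ (P-sym i j) (≈-refl ρ)) ,
  λ x → ≤-trans 0ℝ ((x ∙ (P *ᵛ x)) * ρ) (x ∙ (scale ρ P *ᵛ x))
    (*-nonneg-ℝ (x ∙ (P *ᵛ x)) ρ (psd x) 0≤ρ)
    (≤-reflexive ((x ∙ (P *ᵛ x)) * ρ) (x ∙ (scale ρ P *ᵛ x))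
      (≈-sym (x ∙ (scale ρ P *ᵛ x)) ((x ∙ (P *ᵛ x)) * ρ) (scale-quadratic ρ P x)))

-- Bounds on both theta functions from one matrix.

module _ {n} (H : Graph n) (P : Matrix n) (psd : PSD P)
  (ρ : ℝ) (0≤ρ : 0ℝ ≤ ρ) (ρ-inverse : ρ * tr P ≈ 1ℝ)
  (zero-on-edges : ∀ i j → Adj H i j → P i j ≈ 0ℝ)
  where

  -- `Isϑ` includes attainment: it supplies a representation and a unit handle for which `ϑ` is the
  -- largest 1/(c·uᵢ)², and these feed `weak-duality`.
  entries≤tr*ϑ : ∀ ϑ → Isϑ H ϑ → (sum λ i → sum (P i)) ≤ tr P * ϑ
  entries≤tr*ϑ ϑ ((m , u , (unit , orth) , (c , unit-c , nonzero , _ , max) , _) , _) =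
    ℝₒ.weak-duality P (PSD⇒quadratic-nonneg P psd) u c r ϑ unit unit-c orthogonal
      (λ i → recip-inverseˡ ((c ∙ u i) * (c ∙ u i)) (nonzero i))
      (λ i → max (r i) (i , ≈-refl (r i)))
    where
    r : Fin n → ℝ
    r i = recip ((c ∙ u i) * (c ∙ u i)) (nonzero i)

    orthogonal : ∀ i j → i ≢ j → P i j * (u i ∙ u j) ≈ 0ℝ
    orthogonal i j i≢j = *-zero-dec (P i j) (u i ∙ u j) (adj? H i j)
      (zero-on-edges i j) (orth i j i≢j)

  scaled≤ϑ : ∀ ϑ → Isϑ H ϑ → (𝟏 ∙ (P *ᵛ 𝟏)) * ρ ≤ ϑ
  scaled≤ϑ ϑ isϑ =
    ℝₒ.quotient-≲ {𝟏 ∙ (P *ᵛ 𝟏)} {tr P} {ϑ} {ρ} 0≤ρ ρ-inverse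
      (≤-trans (𝟏 ∙ (P *ᵛ 𝟏)) (sum λ i → sum (P i)) (tr P * ϑ)
        (≤-reflexive (𝟏 ∙ (P *ᵛ 𝟏)) (sum λ i → sum (P i)) (𝟏∙P𝟏≈entries P))
        (entries≤tr*ϑ ϑ isϑ))

  scale-trace : tr (scale ρ P) ≈ 1ℝ
  scale-trace = ≈-trans (tr (scale ρ P)) (tr P * ρ) 1ℝ (ℝₒ.Σ-scale (λ i → P i i) ρ)
    (≈-trans (tr P * ρ) (ρ * tr P) 1ℝ
      (pointwise (tr P * ρ) (ρ * tr P) λ n → ℚ.*-comm (seq (tr P) n) (seq ρ n))
      ρ-inverse)

  -- P / tr P is feasible for the maximum defining ϑ′, with the quotient as its objective value.
  scaled≤ϑ′ : Nonnegative P → ∀ ϑ′ → Isϑ′ H ϑ′ → (𝟏 ∙ (P *ᵛ 𝟏)) * ρ ≤ ϑ′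
  scaled≤ϑ′ nonneg ϑ′ (_ , max) = max ((𝟏 ∙ (P *ᵛ 𝟏)) * ρ)
    (scale ρ P , scale-PSD ρ P 0≤ρ psd , (λ i j → *-nonneg-ℝ (P i j) ρ (nonneg i j) 0≤ρ) ,
     scale-trace , (λ i j ij → ℝₒ.*-zero-factorˡ (P i j) ρ (zero-on-edges i j ij)) ,
     ≈-sym (𝟏 ∙ (scale ρ P *ᵛ 𝟏)) ((𝟏 ∙ (P *ᵛ 𝟏)) * ρ) (scale-quadratic ρ P 𝟏))

theorem7 : ∀ {n : ℕ} .{{_ : NonZero n}} (k : ℕ) .{{_ : NonZero k}}
    (G : Graph n) (A : Matrix n) → A ∈𝒮 G →
    (p : Polynomial≤ k) → PSD (p ⟦ A ⟧) → (tr>0 : 0ℝ < tr (p ⟦ A ⟧)) →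
    (∀ ϑ → Isϑ (complement (G ^ᴳ k)) ϑ →
    (𝟏 ∙ (p ⟦ A ⟧ *ᵛ 𝟏)) / tr (p ⟦ A ⟧) ⟨ inj₂ tr>0 ⟩ ≤ ϑ) ×
    (Nonnegative (p ⟦ A ⟧) → ∀ ϑ′ → Isϑ′ (complement (G ^ᴳ k)) ϑ′ →
    (𝟏 ∙ (p ⟦ A ⟧ *ᵛ 𝟏)) / tr (p ⟦ A ⟧) ⟨ inj₂ tr>0 ⟩ ≤ ϑ′)
theorem7 k G A A∈𝒮 p psd tr>0 =
  scaled≤ϑ (complement (G ^ᴳ k)) (p ⟦ A ⟧) psd (recip (tr (p ⟦ A ⟧)) (inj₂ tr>0))
    (recip-nonneg (tr (p ⟦ A ⟧)) tr>0) (recip-inverseˡ (tr (p ⟦ A ⟧)) (inj₂ tr>0)) far ,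
  scaled≤ϑ′ (complement (G ^ᴳ k)) (p ⟦ A ⟧) psd (recip (tr (p ⟦ A ⟧)) (inj₂ tr>0))
    (recip-nonneg (tr (p ⟦ A ⟧)) tr>0) (recip-inverseˡ (tr (p ⟦ A ⟧)) (inj₂ tr>0)) far
  where
  -- Edges of the complement join vertices at distance more than `k`, infinite distance included, so
  -- p(A) itself serves as `P` in both bounds.
  far : ∀ i j → Adj (complement (G ^ᴳ k)) i j → (p ⟦ A ⟧) i j ≈ 0ℝ
  far i j (i≢j , ¬ij) = polynomial-zero G A A∈𝒮 p i j λ d≤k → ¬ij (i≢j , d≤k)
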